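{- Let $G$ be a finite simple connected graph with at least one edge. Then $\mathrm{dem}(G)=1$ if and only if $G$ is a tree.
   Context: $d_G(x,y)$ denotes the distance between vertices $x,y$ in $G$ (equal to $\infty$ if $x$ and $y$ are in different components), and $G-e$ is the graph obtained from $G$ by deleting the edge $e$. An edge $e$ of $G$ is monitored by a vertex $x$ if there is a vertex $y$ of $G$ with $d_G(x,y)\neq d_{G-e}(x,y)$ (equivalently, $e$ belongs to all shortest paths between $x$ and $y$ in $G$). A set $M\subseteq V(G)$ is distance-edge-monitoring if every edge of $G$ is monitored by some vertex of $M$, and $\mathrm{dem}(G)$ is the smallest size of a distance-edge-monitoring set of $G$. -}

module Defs where

open import Data.Fin.Base using (Fin; zero; suc)
open import Data.Fin.Properties using (_≟_; any?; all?; injective⇒≤)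
open import Data.Fin.Subset using (Subset; _∈_; ∣_∣; ⊤)
open import Data.Fin.Subset.Properties using (_∈?_; ∈⊤; anySubset?)
open import Data.List.Base using (List; []; _∷_; length; lookup)
open import Data.List.Membership.DecPropositional using () renaming (_∈?_ to mem?)
open import Data.List.Membership.Propositional.Properties using (∈-lookup)
open import Data.List.Membership.Propositional using () renaming (_∈_ to _∈ₗ_)
import Data.List.Relation.Unary.All as All
open import Data.List.Relation.Unary.All.Properties using (¬Any⇒All¬)
open import Data.List.Relation.Unary.AllPairs using ([]; _∷_)
open import Data.List.Relation.Unary.Any using (here; there)
open import Data.List.Relation.Unary.Unique.Propositional using (Unique)
open import Data.Maybe.Properties using (≡-dec)
open import Data.Nat.Base using (ℕ; zero; suc; _≤_; _<_; z≤n; s≤s)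
open import Data.Nat.Properties using (anyUpTo?) renaming (_≟_ to _≟ⁿ_)
open import Data.Product.Base using (∃; ∃-syntax; _×_; _,_; proj₁; proj₂)
open import Data.Sum.Base using (_⊎_; inj₁; inj₂)
open import Level using (0ℓ)
open import Relation.Binary.Core using (Rel)
open import Relation.Binary.Definitions using (Decidable; Irreflexive; Symmetric)
open import Relation.Binary.PropositionalEquality using (_≡_; _≢_; refl; sym; cong; subst)
open import Relation.Nullary.Construct.Add.Supremum using (_⁺; ⊤⁺; [_])
open import Relation.Nullary.Decidable using (Dec; yes; no; ¬?; map′; _×-dec_; _⊎-dec_; _→-dec_)
open import Relation.Nullary.Negation using (¬_; contradiction)
import Relation.Unary as Unary

record Graph (n : ℕ) : Set₁ where
  field
    Adj    : Rel (Fin n) 0ℓ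
    adj?   : Decidable Adj
    symm   : Symmetric Adj
    irrefl : Irreflexive _≡_ Adj

open Graph public

-- The last index is the length.
data Walk {n : ℕ} (G : Graph n) : Fin n → Fin n → ℕ → Set where
  []  : ∀ {x} → Walk G x x 0
  _∷_ : ∀ {x y z k} → Adj G x y → Walk G y z k → Walk G x z (suc k)

vertices : ∀ {n} {G : Graph n} {x y k} → Walk G x y k → List (Fin n)
vertices {x = x} []      = x ∷ []
vertices {x = x} (_ ∷ w) = x ∷ vertices w

Connected : ∀ {n} → Graph n → Set
Connected G = ∀ x y → ∃ (Walk G x y)

-- A cycle is a path with at least two edges together with an edge joining its ends.
record Cycle {n : ℕ} (G : Graph n) : Set where
  field
    {start end} : Fin n
    {len}       : ℕ
    path        : Walk G start end len
    distinct    : Unique (vertices path)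
    2≤len       : 2 ≤ len
    closing     : Adj G end start

IsTree : ∀ {n} → Graph n → Set
IsTree G = Connected G × ¬ Cycle G

SameEdge : ∀ {n} (u v x y : Fin n) → Set
SameEdge u v x y = (x ≡ u × y ≡ v) ⊎ (x ≡ v × y ≡ u)

deleteEdge : ∀ {n} → Graph n → (u v : Fin n) → Graph n
deleteEdge G u v = record
  { Adj    = λ x y → Adj G x y × ¬ SameEdge u v x y
  ; adj?   = λ x y → adj? G x y ×-dec
               ¬? ((x ≟ u ×-dec y ≟ v) ⊎-dec (x ≟ v ×-dec y ≟ u))
  ; symm   = λ (a , ne) → symm G a , λ
               { (inj₁ (p , q)) → ne (inj₂ (q , p))
               ; (inj₂ (p , q)) → ne (inj₁ (q , p)) }
  ; irrefl = λ eq (a , _) → irrefl G eq a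
  }

Least : (ℕ → Set) → ℕ → Set
Least P k = P k × (∀ j → P j → k ≤ j)

least : {P : ℕ → Set} → Unary.Decidable P → ∀ m → P m → ∃ (Least P)
least P? zero    p = 0 , p , λ _ _ → z≤n
least P? (suc m) p with P? 0
... | yes p₀ = 0 , p₀ , λ _ _ → z≤n
... | no ¬p₀ with least (λ k → P? (suc k)) m p
...   | k , pₖ , min = suc k , pₖ , λ
          { zero    p₀ → contradiction p₀ ¬p₀
          ; (suc j) pⱼ → s≤s (min j pⱼ) }

-- Distances take values in ℕ ∪ {∞}, with ⊤⁺ as ∞.

IsDistance : ∀ {n} → Graph n → Fin n → Fin n → ℕ ⁺ → Set
IsDistance G x y [ k ] = Least (Walk G x y) k
IsDistance G x y ⊤⁺    = ¬ ∃ (Walk G x y)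

walk? : ∀ {n} (G : Graph n) x y → Unary.Decidable (Walk G x y)
walk? G x y zero    = map′ (λ { refl → [] }) (λ { [] → refl }) (x ≟ y)
walk? G x y (suc k) = map′ (λ (_ , a , w) → a ∷ w) (λ { (a ∷ w) → _ , a , w })
                           (any? λ z → adj? G x z ×-dec walk? G z y k)

-- Every walk can be shortened to a path, so to length less than n.

Path : ∀ {n} → Graph n → Fin n → Fin n → ℕ → Set
Path G x y k = ∃[ w ] Unique (vertices {G = G} {x} {y} {k} w)

suffix : ∀ {n} {G : Graph n} {x y z k} ((w , _) : Path G x y k) →
         z ∈ₗ vertices w → ∃ (Path G z y)
suffix p@([] , _)         (here refl) = _ , p
suffix p@(_ ∷ _ , _)      (here refl) = _ , p
suffix   (_ ∷ w , _ ∷ uq) (there z∈w) = suffix (w , uq) z∈w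

toPath : ∀ {n} {G : Graph n} {x y k} → Walk G x y k → ∃ (Path G x y)
toPath []            = 0 , [] , (All.[] ∷ [])
toPath {x = x} (a ∷ w) with toPath w
... | k , p , uq with mem? _≟_ x (vertices p)
...   | yes x∈p = suffix (p , uq) x∈p
...   | no  x∉p = suc k , a ∷ p , ¬Any⇒All¬ _ x∉p ∷ uq

length-vertices : ∀ {n} {G : Graph n} {x y k} (w : Walk G x y k) →
                  length (vertices w) ≡ suc k
length-vertices []      = refl
length-vertices (_ ∷ w) rewrite length-vertices w = refl

lookup-injective : ∀ {n} {xs : List (Fin n)} → Unique xs →
                   ∀ {i j} → lookup xs i ≡ lookup xs j → i ≡ j
lookup-injective (_  ∷ _)  {zero}  {zero}  _  = refl
lookup-injective (x∉ ∷ _)  {zero}  {suc j} eq = contradiction eq (All.lookup x∉ (∈-lookup j))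
lookup-injective (x∉ ∷ _)  {suc i} {zero}  eq = contradiction (sym eq) (All.lookup x∉ (∈-lookup i))
lookup-injective (_  ∷ uq) {suc i} {suc j} eq = cong suc (lookup-injective uq eq)

path-length : ∀ {n} {G : Graph n} {x y k} → Path G x y k → k < n
path-length {n} (w , uq) = subst (_≤ n) (length-vertices w)
  (injective⇒≤ {f = lookup (vertices w)} (lookup-injective uq))

distance : ∀ {n} (G : Graph n) x y → ∃ (IsDistance G x y)
distance {n} G x y with anyUpTo? (walk? G x y) n
... | yes (m , _ , w) = let (k , lk) = least (walk? G x y) m w in [ k ] , lk
... | no  ¬w          = ⊤⁺ , λ (_ , w) → let (k , p) = toPath w in
                          ¬w (k , path-length p , proj₁ p)

d : ∀ {n} → Graph n → Fin n → Fin n → ℕ ⁺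
d G x y = proj₁ (distance G x y)

-- The edge with ends u and v is monitored by x. Edges are given as ordered
-- pairs of adjacent vertices; deleteEdge removes both orientations.
Monitors : ∀ {n} → Graph n → (u v x : Fin n) → Set
Monitors G u v x = ∃[ y ] d G x y ≢ d (deleteEdge G u v) x y

DistanceEdgeMonitoring : ∀ {n} → Graph n → Subset n → Set
DistanceEdgeMonitoring G M =
  ∀ u v → Adj G u v → ∃[ x ] x ∈ M × Monitors G u v x

distanceEdgeMonitoring? : ∀ {n} (G : Graph n) → Unary.Decidable (DistanceEdgeMonitoring G)
distanceEdgeMonitoring? G M =
  all? λ u → all? λ v → adj? G u v →-dec any? λ x → x ∈? M ×-dec
    any? λ y → ¬? (≡-dec _≟ⁿ_ (d G x y) (d (deleteEdge G u v) x y))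

end-monitors : ∀ {n} (G : Graph n) u v → Adj G u v → Monitors G u v u
end-monitors G u v a = v , λ eq →
  impossible (d G u v) (proj₂ (distance G u v))
    (subst (IsDistance G-e u v) (sym eq) (proj₂ (distance G-e u v)))
  where
  G-e = deleteEdge G u v
  impossible : ∀ δ → IsDistance G u v δ → ¬ IsDistance G-e u v δ
  impossible ⊤⁺    ¬w        _ = ¬w (1 , a ∷ [])
  impossible [ 0 ] ([] , _)  _ = irrefl G refl a
  impossible [ 1 ] _         ((_ , ne) ∷ [] , _) = ne (inj₁ (refl , refl))
  impossible [ suc (suc _) ] (_ , min) _ with min 1 (a ∷ [])
  ... | s≤s ()

⊤-monitoring : ∀ {n} (G : Graph n) → DistanceEdgeMonitoring G ⊤
⊤-monitoring G u v a = u , ∈⊤ , end-monitors G u v a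

MonitoringSetOfSize : ∀ {n} → Graph n → ℕ → Set
MonitoringSetOfSize G k = ∃[ M ] DistanceEdgeMonitoring G M × ∣ M ∣ ≡ k

leastMonitoringSize : ∀ {n} (G : Graph n) → ∃ (Least (MonitoringSetOfSize G))
leastMonitoringSize {n} G =
  least (λ k → anySubset? λ M → distanceEdgeMonitoring? G M ×-dec (∣ M ∣ ≟ⁿ k))
        ∣ ⊤ {n} ∣ (⊤ , ⊤-monitoring G , refl)

dem : ∀ {n} → Graph n → ℕ
dem G = proj₁ (leastMonitoringSize G)

{-# OPTIONS --safe #-}

-- If {x} is monitoring, let h be the distance from x, and call c a parent of
-- y when c is a neighbour of y with h y = h c + 1. Deleting an edge changes a
-- distance from x only if it is the sole edge from some vertex to a parent of
-- it, so every edge joins a vertex to its unique parent. A path that has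
-- climbed then cannot descend again, since that would mean returning to the
-- parent just left; hence no cycle closes up.
-- Conversely, if x monitors no change at either end of an edge uv, then G - uv
-- contains a path from u to v through the component of x, and uv closes it to
-- a cycle. So in a tree every single vertex is a monitoring set.

module Submission where

open import Defs
open import Data.Fin.Base using (Fin)
open import Data.Fin.Properties using (_≟_; any?; all?; ¬∀⟶∃¬)
open import Data.Fin.Subset using (Subset; _∈_; ∣_∣; ⁅_⁆; _⊆_)
open import Data.Fin.Subset.Properties
  using (x∈⁅x⁆; x∈⁅y⁆⇒x≡y; ∣⁅x⁆∣≡1; p⊆q⇒∣p∣≤∣q∣; p⊂q⇒∣p∣<∣q∣)
open import Data.List.Base using (_∷_)
open import Data.List.Membership.Propositional renaming (_∈_ to _∈ₗ_; _∉_ to _∉ₗ_)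
open import Data.List.Relation.Unary.All.Properties using (All¬⇒¬Any)
open import Data.List.Relation.Unary.AllPairs using (_∷_)
open import Data.List.Relation.Unary.Any using (here; there)
open import Data.List.Relation.Unary.Unique.Propositional using (Unique)
open import Data.Maybe.Properties using (≡-dec)
open import Data.Nat.Base using (ℕ; zero; suc; _+_; _≤_; _<_; z≤n; s≤s)
open import Data.Nat.Properties as ℕ
  using (≤-refl; ≤-reflexive; ≤-trans; ≤-antisym; suc-injective; module ≤-Reasoning)
open import Data.Product.Base using (∃; ∃₂; ∃-syntax; _×_; _,_; proj₁; proj₂; uncurry)
open import Data.Sum.Base using (_⊎_; inj₁; inj₂)
open import Function.Base using (_∘_)
open import Function.Bundles using (_⇔_; mk⇔)
open import Relation.Binary.PropositionalEquality
  using (_≡_; _≢_; refl; sym; trans; cong; subst)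
open import Relation.Nullary.Construct.Add.Supremum using (⊤⁺; [_])
open import Relation.Nullary.Decidable using (Dec; yes; no; _×-dec_; _⊎-dec_; decidable-stable)
open import Relation.Nullary.Negation using (¬_; contradiction)

private variable
  n k l : ℕ
  x y z u v : Fin n
  G : Graph n

-- Walks, distances and one-element sets

_∷ʳʷ_ : Walk G x y k → Adj G y z → Walk G x z (suc k)
[]      ∷ʳʷ b = b ∷ []
(a ∷ w) ∷ʳʷ b = a ∷ (w ∷ʳʷ b)

unsnoc : Walk G x z (suc k) → ∃[ y ] Walk G x y k × Adj G y z
unsnoc (a ∷ [])      = _ , [] , a
unsnoc (a ∷ w@(_ ∷ _)) = let (y , w′ , b) = unsnoc w in y , a ∷ w′ , b

_++ʷ_ : Walk G x y k → Walk G y z l → Walk G x z (k + l)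
[]      ++ʷ w′ = w′
(a ∷ w) ++ʷ w′ = a ∷ (w ++ʷ w′)

reverseʷ : Walk G x y k → Walk G y x k
reverseʷ         []      = []
reverseʷ {G = G} (a ∷ w) = reverseʷ w ∷ʳʷ symm G a

end∈vertices : (w : Walk G x y k) → y ∈ₗ vertices w
end∈vertices []      = here refl
end∈vertices (_ ∷ w) = there (end∈vertices w)

start∈vertices : (w : Walk G x y k) → x ∈ₗ vertices w
start∈vertices []      = here refl
start∈vertices (_ ∷ _) = here refl

undelete : Walk (deleteEdge G u v) x y k → Walk G x y k
undelete []            = []
undelete ((a , _) ∷ w) = a ∷ undelete w

vertices-undelete : (w : Walk (deleteEdge G u v) x y k) →
                    vertices (undelete {G = G} w) ≡ vertices w
vertices-undelete []                    = refl
vertices-undelete {x = x} ((_ , _) ∷ w) = cong (x ∷_) (vertices-undelete w)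

sameEdge? : (u v x y : Fin n) → Dec (SameEdge u v x y)
sameEdge? u v x y = (x ≟ u ×-dec y ≟ v) ⊎-dec (x ≟ v ×-dec y ≟ u)

Least-unique : ∀ {P k l} → Least P k → Least P l → k ≡ l
Least-unique (pₖ , minₖ) (pₗ , minₗ) = ≤-antisym (minₖ _ pₗ) (minₗ _ pₖ)

-- The search behind `d` stops at a least length, and least lengths are unique.
d-least : Least (Walk G x y) k → d G x y ≡ [ k ]
d-least {G = G} {x} {y} lk with distance G x y
... | [ _ ] , lj = cong [_] (Least-unique lj lk)
... | ⊤⁺    , ¬w = contradiction (_ , proj₁ lk) ¬w

d-finite : d G x y ≡ [ k ] → Walk G x y k
d-finite {G = G} {x} {y} eq with distance G x y
d-finite refl | [ _ ] , w , _ = w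

singleton-⊆ : {M : Subset n} → x ∈ M → ⁅ x ⁆ ⊆ M
singleton-⊆ {M = M} x∈M y∈ = subst (_∈ M) (sym (x∈⁅y⁆⇒x≡y _ y∈)) x∈M

∣M∣≡1⇒unique : {M : Subset n} → ∣ M ∣ ≡ 1 → x ∈ M → y ∈ M → y ≡ x
∣M∣≡1⇒unique {x = x} {y} {M} ∣M∣≡1 x∈M y∈M with y ≟ x
... | yes eq = eq
... | no  ne = contradiction
  (p⊂q⇒∣p∣<∣q∣ (singleton-⊆ x∈M , y , y∈M , ne ∘ x∈⁅y⁆⇒x≡y _))
  (ℕ.<-irrefl (trans (∣⁅x⁆∣≡1 x) (sym ∣M∣≡1)))

-- Unique parents exclude cycles

module _ {n} (G : Graph n) (h : Fin n → ℕ) where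

  Parent : Fin n → Fin n → Set
  Parent c y = Adj G c y × h y ≡ suc (h c)

  UniqueParent : Fin n → Fin n → Set
  UniqueParent c y = Parent c y × (∀ b → Parent b y → b ≡ c)

  module _ (orient : ∀ {u v} → Adj G u v → UniqueParent u v ⊎ UniqueParent v u) where

    -- Were `b` the lower end, it would be a second parent of `y`.
    orient-other : ∀ {c y b} → UniqueParent c y → Adj G b y → b ≢ c → UniqueParent y b
    orient-other (_ , uniq) a b≢c with orient a
    ... | inj₁ (p , _) = contradiction (uniq _ p) b≢c
    ... | inj₂ up      = up

    below : ∀ {c y} → UniqueParent c y → h c < h y
    below ((_ , eq) , _) = ≤-reflexive (sym eq)

    -- A path that avoids the parent of its first vertex can leave that vertex only upwards; the
    -- same then holds at the next vertex, because the path never returns.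
    ascend : ∀ {b z y k} → UniqueParent b z → (w : Walk G z y k) →
             Unique (vertices w) → b ∉ₗ vertices w → h z ≤ h y
    ascend up []      _          _   = ≤-refl
    ascend up (a ∷ w) (z∉ ∷ uq) b∉ =
      ≤-trans (ℕ.<⇒≤ (below up′)) (ascend up′ w uq (All¬⇒¬Any z∉))
      where
      up′ = orient-other up (symm G a)
              λ { refl → b∉ (there (start∈vertices w)) }

    -- A path that avoids the parent c of its last vertex y can enter y only
    -- from above, so, traced backwards, it climbs all the way to b.
    descend : ∀ {c y b z k} → UniqueParent c y → (w : Walk G z y k) →
              Unique (vertices w) → c ∉ₗ vertices w →
              Adj G b z → b ≢ c → b ∉ₗ vertices w →
              UniqueParent z b × h y ≤ h z
    descend up []      _         _  ab b≢c _  = orient-other up ab b≢c , ≤-refl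
    descend up (a ∷ w) (z∉ ∷ uq) c∉ ab _   b∉
      with descend up w uq (c∉ ∘ there) a (c∉ ∘ here ∘ sym) (All¬⇒¬Any z∉)
    ... | up′ , hy≤ =
      orient-other up′ ab (λ { refl → b∉ (there (start∈vertices w)) }) ,
      ≤-trans hy≤ (ℕ.<⇒≤ (below up′))

    acyclic : ¬ Cycle G
    acyclic record { path = _ ∷ [] ; 2≤len = s≤s () }
    acyclic record { path = a ∷ w@(b ∷ w′) ; distinct = s∉ ∷ uq@(s₁∉ ∷ uq′)
                   ; closing = c } with orient c
    -- The end is the parent of the start: the path leaves the start upwards and never comes down,
    -- yet would have to finish lower.
    ... | inj₁ up = ℕ.<-irrefl refl
      (ℕ.<-≤-trans (ℕ.<-trans (below up) (below up′)) (ascend up′ w uq (All¬⇒¬Any s∉)))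
      where
      up′ = orient-other up (symm G a)
              λ { refl → All¬⇒¬Any s₁∉ (end∈vertices w′) }
    -- The start is the parent of the end: traced backwards the path climbs all the way, so the
    -- start would be higher than its own child.
    ... | inj₂ up = ℕ.<-irrefl refl
      (ℕ.<-≤-trans (ℕ.<-trans (below up) (ℕ.≤-<-trans (proj₂ down) (below (proj₁ down))))
                   (ℕ.<⇒≤ (below up′)))
      where
      down = descend up w′ uq′ (All¬⇒¬Any s∉ ∘ there) b
               (All¬⇒¬Any s∉ ∘ here ∘ sym) (All¬⇒¬Any s₁∉)
      up′ = orient-other (proj₁ down) a
              λ { refl → All¬⇒¬Any s∉ (there (start∈vertices w′)) }

-- The distance from a vertex that monitors every edge

module _ {n} (G : Graph n) (conn : Connected G) (x : Fin n) where

  private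
    h-least : ∀ y → ∃ (Least (Walk G x y))
    h-least y = uncurry (least (walk? G x y)) (conn x y)

  h : Fin n → ℕ
  h = proj₁ ∘ h-least

  h-walk : ∀ y → Walk G x y (h y)
  h-walk y = proj₁ (proj₂ (h-least y))

  h-min : ∀ {y k} → Walk G x y k → h y ≤ k
  h-min {y} = proj₂ (proj₂ (h-least y)) _

  -- When `h y` is positive, the penultimate vertex of a shortest walk from `x` is a parent.
  hasParent : ∀ y → h y ≡ 0 ⊎ ∃[ c ] Parent G h c y
  hasParent y with h y in eq | h-walk y
  ... | zero  | _ = inj₁ refl
  ... | suc k | w with unsnoc w
  ...   | c , w′ , a = inj₂ (c , a , cong suc (≤-antisym k≤hc (h-min w′)))
    where
    k≤hc : k ≤ h c
    k≤hc = ℕ.≤-pred (subst (_≤ suc (h c)) eq (h-min (h-walk c ∷ʳʷ a)))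

  module _ {u v : Fin n} where

    private
      G-e = deleteEdge G u v

      -- Heights stay those of `G`; only the edge to the parent has to survive the deletion.
      Supported : Fin n → Set
      Supported y = h y ≡ 0 ⊎ ∃[ c ] Adj G-e c y × h y ≡ suc (h c)

      supported? : ∀ y → Dec (Supported y)
      supported? y = (h y ℕ.≟ 0) ⊎-dec
                     any? λ c → adj? G-e c y ×-dec (h y ℕ.≟ suc (h c))

    -- Surviving parent edges are followed down to `x`. Each lowers the height by one, so the walk
    -- is as short as in `G`; `k` makes the recursion structural.
    supported⇒walk : (∀ y → Supported y) → ∀ k y → h y ≡ k → Walk G-e x y k
    supported⇒walk sup zero    y eq with subst (Walk G x y) eq (h-walk y)
    ... | [] = []
    supported⇒walk sup (suc k) y eq with sup y
    ... | inj₁ eq₀           = contradiction (trans (sym eq) eq₀) λ ()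
    ... | inj₂ (c , a , eqc) =
      supported⇒walk sup k c (suc-injective (trans (sym eqc) eq)) ∷ʳʷ a

    supported⇒¬monitors : (∀ y → Supported y) → ¬ Monitors G u v x
    supported⇒¬monitors sup (y , ne) = ne (trans
      (d-least (h-walk y , λ _ → h-min))
      (sym (d-least (supported⇒walk sup (h y) y refl , λ _ → h-min ∘ undelete))))

    -- Some vertex `y` loses every edge to a parent. Only one edge is deleted, so `y` is an end of
    -- it and the other end is its sole parent.
    monitors⇒orient : Monitors G u v x → UniqueParent G h u v ⊎ UniqueParent G h v u
    monitors⇒orient mon with all? supported?
    ... | yes sup = contradiction mon (supported⇒¬monitors sup)
    ... | no ¬sup with ¬∀⟶∃¬ n Supported supported? ¬sup
    ...   | y , ¬sy with hasParent y
    ...     | inj₁ eq      = contradiction (inj₁ eq) ¬sy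
    ...     | inj₂ (c , p) = conclude (same c p)
      where
      same : ∀ b → Parent G h b y → SameEdge u v b y
      same b (a , eq) = decidable-stable (sameEdge? u v b y)
        λ ne → ¬sy (inj₂ (b , (a , ne) , eq))

      conclude : SameEdge u v c y → UniqueParent G h u v ⊎ UniqueParent G h v u
      conclude (inj₁ (refl , refl)) = inj₁ (p , λ b q → case-same (same b q))
        where
        case-same : ∀ {b} → SameEdge u v b v → b ≡ u
        case-same (inj₁ (eq , _))    = eq
        case-same (inj₂ (eq , v≡u)) = trans eq v≡u
      conclude (inj₂ (refl , refl)) = inj₂ (p , λ b q → case-same (same b q))
        where
        case-same : ∀ {b} → SameEdge u v b u → b ≡ v
        case-same (inj₁ (eq , u≡v)) = trans eq u≡v
        case-same (inj₂ (eq , _))    = eq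

-- Monitoring in trees, and the two implications

tree⇒monitors : IsTree G → ∀ x → Adj G u v → Monitors G u v x
tree⇒monitors {G = G} {u} {v} (conn , ¬cycle) x a
  with same-d? u | same-d? v
  where
  same-d? : ∀ y → Dec (d G x y ≡ d (deleteEdge G u v) x y)
  same-d? y = ≡-dec ℕ._≟_ _ _
... | no ne  | _      = u , ne
... | yes _  | no ne  = v , ne
... | yes eu | yes ev = contradiction
  (close (toPath (reverseʷ (reach u eu) ++ʷ reach v ev))) ¬cycle
  where
  G-e = deleteEdge G u v

  -- Connectedness makes the distance in `G` finite, so the equal distance in `G-e` is realised by a
  -- walk.
  reach : ∀ y → d G x y ≡ d G-e x y → Walk G-e x y (h G conn x y)
  reach y eq = d-finite (trans (sym eq)
    (d-least (h-walk G conn x y , λ _ → h-min G conn x)))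

  close : ∃ (Path G-e u v) → Cycle G
  -- Length 0 would make the edge a loop, and length 1 would be the deleted edge itself.
  close (0 , [] , _)                   = contradiction a (irrefl G refl)
  close (1 , ((_ , ne) ∷ []) , _)      = contradiction (inj₁ (refl , refl)) ne
  close (suc (suc _) , w , uq)         = record
    { path     = undelete w
    ; distinct = subst Unique (sym (vertices-undelete w)) uq
    ; 2≤len    = s≤s (s≤s z≤n)
    ; closing  = symm G a
    }

dem≡1⇒tree : Connected G → ∃₂ (Adj G) → dem G ≡ 1 → IsTree G
dem≡1⇒tree {G = G} conn (_ , _ , a₀) eq with leastMonitoringSize G
dem≡1⇒tree {G = G} conn (u₀ , v₀ , a₀) refl | _ , (M , mon , ∣M∣≡1) , _
  -- The given edge supplies an element of `M`, which is then its only one.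
  with mon u₀ v₀ a₀
... | x , x∈M , _ = conn , acyclic G (h G conn x) (monitors⇒orient G conn x ∘ monitored)
  where
  monitored : ∀ {u v} → Adj G u v → Monitors G u v x
  monitored a with mon _ _ a
  ... | y , y∈M , m = subst (Monitors G _ _) (∣M∣≡1⇒unique ∣M∣≡1 x∈M y∈M) m

tree⇒dem≡1 : ∃₂ (Adj G) → IsTree G → dem G ≡ 1
tree⇒dem≡1 {G = G} (u₀ , v₀ , a₀) tree with leastMonitoringSize G
... | k , (M , mon , ∣M∣≡k) , min = ≤-antisym
  (min 1 (⁅ u₀ ⁆ , (λ _ _ a → u₀ , x∈⁅x⁆ u₀ , tree⇒monitors tree u₀ a) , ∣⁅x⁆∣≡1 u₀))
  -- The given edge needs a monitoring vertex, so `M` is not empty.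
  (let (x , x∈M , _) = mon u₀ v₀ a₀ in begin
    1            ≡⟨ ∣⁅x⁆∣≡1 x ⟨
    ∣ ⁅ x ⁆ ∣    ≤⟨ p⊆q⇒∣p∣≤∣q∣ (singleton-⊆ x∈M) ⟩
    ∣ M ∣        ≡⟨ ∣M∣≡k ⟩
    k            ∎)
  where open ≤-Reasoning

theorem9 : (n : ℕ) (G : Graph n) → Connected G → ∃₂ (Adj G) → (dem G ≡ 1) ⇔ IsTree G
theorem9 n G conn edge = mk⇔ (dem≡1⇒tree conn edge) (tree⇒dem≡1 edge)
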